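{- For every integer $k \geq 1$, there are, up to isomorphism, only finitely many $k$-vertex-critical $(P_5,\text{chair})$-free graphs.
   Context: All graphs are finite and simple. For graphs $G, F_1, F_2$, $G$ is $(F_1,F_2)$-free if neither $F_1$ nor $F_2$ is (isomorphic to) an induced subgraph of $G$. $\chi(G)$ denotes the chromatic number of $G$. A graph $G$ is $k$-vertex-critical if $\chi(G)=k$ but $\chi(G-v)<k$ for every vertex $v\in V(G)$. $P_5$ is the path on $5$ vertices. The chair is the $5$-vertex graph obtained from a path on $4$ vertices by adding a pendant vertex (a new vertex of degree one) adjacent to one of the two central vertices of the path. -}

module Defs where

open import Data.Empty using (⊥)
open import Data.Fin using (Fin; zero; suc; toℕ; punchIn; _≟_)
open import Data.List using (List)
open import Data.List.Relation.Unary.All using (All)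
open import Data.List.Relation.Unary.Any using (Any)
open import Data.Nat using (ℕ; zero; suc; pred; _<_)
import Data.Nat as ℕ
open import Data.Nat.Properties using (1+n≢n)
open import Data.Product using (Σ-syntax; ∃; ∃-syntax; _×_; _,_)
open import Data.Sum using (_⊎_; inj₁; inj₂; swap)
open import Function.Bundles using (_⇔_; _↔_; _↣_; module Inverse; module Injection)
open import Level using (0ℓ)
open import Relation.Binary.Core using (Rel)
open import Relation.Binary.Definitions using (Symmetric; Decidable)
open import Relation.Binary.PropositionalEquality using (_≡_; _≢_)
open import Relation.Nullary using (¬_; no)
open import Relation.Nullary.Decidable using (_⊎-dec_)

-- Finite simple graphs on the vertex set Fin n.  Up to isomorphism these
-- are all the finite simple graphs with n vertices.
record Graph (n : ℕ) : Set₁ where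
  field
    Adj    : Rel (Fin n) 0ℓ
    adj?   : Decidable Adj
    sym    : Symmetric Adj
    irrefl : ∀ v → ¬ Adj v v

open Graph public

record _≅_ {m n : ℕ} (G : Graph m) (H : Graph n) : Set where
  field
    bijection : Fin m ↔ Fin n
    adj-⇔     : ∀ u v → Adj G u v ⇔ Adj H (Inverse.to bijection u) (Inverse.to bijection v)

-- F ⊑ G: F is isomorphic to an induced subgraph of G, namely the one
-- induced by the image of the embedding.
record _⊑_ {m n : ℕ} (F : Graph m) (G : Graph n) : Set where
  field
    embedding : Fin m ↣ Fin n
    adj-⇔     : ∀ u v → Adj F u v ⇔ Adj G (Injection.to embedding u) (Injection.to embedding v)

⟨_,_⟩-Free : {m₁ m₂ n : ℕ} → Graph m₁ → Graph m₂ → Graph n → Set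
⟨ F₁ , F₂ ⟩-Free G = ¬ (F₁ ⊑ G) × ¬ (F₂ ⊑ G)

-- Vertex deletion.  The remaining vertices are renumbered by punchIn v,
-- the order-preserving injection whose image is everything except v.
_−_ : {n : ℕ} → Graph n → Fin n → Graph (pred n)
_−_ {suc n} G v = record
  { Adj    = λ i j → Adj G (punchIn v i) (punchIn v j)
  ; adj?   = λ i j → adj? G (punchIn v i) (punchIn v j)
  ; sym    = sym G
  ; irrefl = λ i → irrefl G (punchIn v i)
  }

Colourable : {n : ℕ} → Graph n → ℕ → Set
Colourable {n} G k = Σ[ c ∈ (Fin n → Fin k) ] (∀ u v → Adj G u v → c u ≢ c v)

-- χ G ≔ k: the chromatic number of G is k.  It is a relation, functional in
-- k; the graph without vertices has chromatic number 0.
χ_≔_ : {n : ℕ} → Graph n → ℕ → Set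
χ G ≔ k = Colourable G k × (∀ j → j < k → ¬ Colourable G j)

VertexCritical : ℕ → {n : ℕ} → Graph n → Set
VertexCritical k {n} G =
  (χ G ≔ k) × ((v : Fin n) → ∃[ j ] ((χ (G − v) ≔ j) × j < k))

path : (n : ℕ) → Graph n
path n = record
  { Adj    = λ i j → suc (toℕ i) ≡ toℕ j ⊎ suc (toℕ j) ≡ toℕ i
  ; adj?   = λ i j → (suc (toℕ i) ℕ.≟ toℕ j) ⊎-dec (suc (toℕ j) ℕ.≟ toℕ i)
  ; sym    = swap
  ; irrefl = λ { v (inj₁ e) → 1+n≢n e ; v (inj₂ e) → 1+n≢n e }
  }

-- The new vertex is zero, and each old vertex i becomes suc i.
addPendant : {n : ℕ} → Graph n → Fin n → Graph (suc n)
addPendant {n} G w = record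
  { Adj = Adj′ ; adj? = adj?′ ; sym = λ {i} {j} → sym′ i j ; irrefl = irrefl′ }
  where
  Adj′ : Rel (Fin (suc n)) 0ℓ
  Adj′ zero    zero    = ⊥
  Adj′ zero    (suc j) = j ≡ w
  Adj′ (suc i) zero    = i ≡ w
  Adj′ (suc i) (suc j) = Adj G i j

  adj?′ : Decidable Adj′
  adj?′ zero    zero    = no (λ ())
  adj?′ zero    (suc j) = j ≟ w
  adj?′ (suc i) zero    = i ≟ w
  adj?′ (suc i) (suc j) = adj? G i j

  sym′ : ∀ i j → Adj′ i j → Adj′ j i
  sym′ zero    (suc j) e = e
  sym′ (suc i) zero    e = e
  sym′ (suc i) (suc j) e = sym G e

  irrefl′ : ∀ v → ¬ Adj′ v v
  irrefl′ (suc v) e = irrefl G v e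

P₅ : Graph 5
P₅ = path 5

chair : Graph 5
chair = addPendant (path 4) (suc zero)

FiniteGraph : Set₁
FiniteGraph = ∃ Graph

_≅ᶠ_ : FiniteGraph → FiniteGraph → Set
(_ , G) ≅ᶠ (_ , H) = G ≅ H

-- There is a list of graphs satisfying P that contains, up to isomorphism,
-- every graph satisfying P.  Repetitions in the list are harmless.
FinitelyManyUpToIso : (P : {n : ℕ} → Graph n → Set) → Set₁
FinitelyManyUpToIso P =
  Σ[ Gs ∈ List FiniteGraph ]
    (All (λ (_ , H) → P H) Gs × ({n : ℕ} (G : Graph n) → P G → Any ((n , G) ≅ᶠ_) Gs))

{-# OPTIONS --safe #-}

-- The bound on the size of a (k + 1)-vertex-critical graph G is found by
-- recursion on k.  If a vertex b has huge degree, Ramsey's theorem gives a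
-- huge stable set in N(b).  After deleting boundedly many vertices from it, no
-- vertex of G misses exactly one vertex of the remaining stable set T: vertices
-- y₁, y₂, … responsible for successive deletions would form, by P₅- and
-- chair-freeness, two cliques.  Let Z be the set of vertices complete to T.
-- Chair-freeness makes the set M of all vertices outside Z that are complete to
-- Z a module.  It contains T, and it is vertex-critical with a smaller chromatic
-- number because b ∈ Z, which bounds |T|.  Hence G has bounded degree; being
-- connected and P₅-free, it is a ball of radius three.
module Submission where

open import Defs
open import Data.Empty using (⊥; ⊥-elim)
open import Data.Bool using (if_then_else_)
open import Data.Fin using
  (Fin; zero; suc; toℕ; fromℕ<; punchIn; punchOut; combine; remQuot; finToFun; funToFin; _≟_)
open import Data.Fin.Properties using
  ( any?; all?; toℕ<n; toℕ-fromℕ<; toℕ-injective; punchIn-punchOut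
  ; remQuot-combine; finToFun-funToFin )
open import Data.List using
  (List; []; _∷_; [_]; allFin; length; filter; map; upTo; concatMap)
import Data.List.Membership.DecPropositional as DecMembership
open import Data.List.Membership.Propositional using (_∈_; _∉_; find)
open import Data.List.Membership.Propositional.Properties using
  ( ∈-filter⁺; ∈-filter⁻; ∈-upTo⁺; ∈-upTo⁻; ∈-map⁺; ∈-map⁻; ∈-allFin
  ; ∈-concatMap⁺; ∈-concatMap⁻ )
open import Data.List.Properties using
  (filter-notAll; length-upTo; length-map; length-++; length-tabulate)
open import Data.List.Relation.Binary.Subset.Propositional using (_⊆_)
open import Data.List.Relation.Unary.All as All using (All; []; _∷_)
open import Data.List.Relation.Unary.All.Properties as All using
  (¬All⇒Any¬; ¬Any⇒All¬; all-filter)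
open import Data.List.Relation.Unary.AllPairs using (AllPairs; []; _∷_)
import Data.List.Relation.Unary.AllPairs.Properties as AllPairs
open import Data.List.Relation.Unary.Any as Any using (Any; here; there)
open import Data.List.Relation.Unary.Unique.Propositional using (Unique)
import Data.List.Relation.Unary.Unique.Propositional.Properties as Unique
open import Data.Nat hiding (_≟_)
import Data.Nat as ℕ
open import Data.Nat.Properties hiding (_≟_)
open import Data.Product using (∃; ∃-syntax; Σ-syntax; _×_; _,_; proj₁; proj₂)
open import Data.Sum as Sum using (_⊎_; inj₁; inj₂)
open import Data.Unit using (⊤; tt)
import Data.Vec as Vec
open Vec using ([]; _∷_)
open import Function using (_∘_; id; mk⇔; mk↣; _⇔_; Equivalence; Injection)
open import Function.Construct.Composition using (_⇔-∘_)
open import Function.Construct.Identity using (↔-id)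
open import Function.Construct.Symmetry using (⇔-sym)
open import Level using (0ℓ)
open import Relation.Binary.Core using (Rel)
open import Relation.Binary.Definitions using (DecidableEquality)
  renaming (Decidable to Decidable₂)
open import Relation.Binary.PropositionalEquality using
  (_≡_; _≢_; refl; trans; cong; subst; subst₂) renaming (sym to ≡-sym)
open import Relation.Nullary using (¬_; Dec; yes; no; does; ¬?; contradiction)
open import Relation.Nullary.Decidable using
  (map′; _×-dec_; _⊎-dec_; _→-dec_; decidable-stable)
open import Relation.Unary using (Pred; Decidable)

-- Counting in lists.

private variable
  A : Set

unique-⊆⇒length≤ : DecidableEquality A → {xs ys : List A} →
  Unique xs → xs ⊆ ys → length xs ≤ length ys
unique-⊆⇒length≤ _≟_ {[]} _ _ = z≤n
unique-⊆⇒length≤ _≟_ {x ∷ xs} {ys} (x∉xs ∷ xs!) xs⊆ys =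
  ≤-<-trans
    (unique-⊆⇒length≤ _≟_ xs! λ y∈xs →
      ∈-filter⁺ ≢x? (xs⊆ys (there y∈xs)) (All.lookup x∉xs y∈xs))
    (filter-notAll ≢x? ys (Any.map (λ x≡y x≢y → x≢y x≡y) (xs⊆ys (here refl))))
  where
  ≢x? : Decidable (x ≢_)
  ≢x? y = ¬? (x ≟ y)

length-concatMap-≤ : {f : A → List A} {d : ℕ} (xs : List A) →
  (∀ {x} → x ∈ xs → length (f x) ≤ d) → length (concatMap f xs) ≤ length xs * d
length-concatMap-≤ [] f≤d = z≤n
length-concatMap-≤ {f = f} (x ∷ xs) f≤d rewrite length-++ (f x) {concatMap f xs} =
  +-mono-≤ (f≤d (here refl)) (length-concatMap-≤ xs (f≤d ∘ there))

length-filter-∁ : {P : Pred A 0ℓ} (P? : Decidable P) → ∀ xs →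
  length xs ≤ length (filter P? xs) + length (filter (¬? ∘ P?) xs)
length-filter-∁ P? [] = z≤n
length-filter-∁ P? (x ∷ xs) with P? x
... | yes _ = s≤s (length-filter-∁ P? xs)
... | no _ rewrite +-suc (length (filter P? xs)) (length (filter (¬? ∘ P?) xs)) =
  s≤s (length-filter-∁ P? xs)

+-≤-split : ∀ {m n p q} → m + n ≤ p + q → m ≤ p ⊎ n ≤ q
+-≤-split {m} {n} {p} {q} le with m ≤? p | n ≤? q
... | yes m≤p | _       = inj₁ m≤p
... | no  _   | yes n≤q = inj₂ n≤q
... | no  m≰p | no  n≰q = contradiction le (<⇒≱ (+-mono-< (≰⇒> m≰p) (≰⇒> n≰q)))

-- Ramsey's theorem for duplicate-free lists.

ramseyBound : ℕ → ℕ → ℕ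
ramseyBound zero    b       = 0
ramseyBound (suc a) zero    = 0
-- The `suc` pays for the pivot `x`, so that the tail still has as many entries as the two smaller
-- bounds together.
ramseyBound (suc a) (suc b) = suc (ramseyBound a (suc b) + ramseyBound (suc a) b)

module _ {R : Rel A 0ℓ} (R? : Decidable₂ R) where

  -- Only the stable list has to be declared duplicate-free: for an irreflexive `R`, such as
  -- adjacency, a clique list is so automatically.
  Clique≥ Stable≥ : ℕ → List A → Set
  Clique≥ a xs = ∃[ ys ] ys ⊆ xs × AllPairs R ys × a ≤ length ys
  Stable≥ b xs = ∃[ ys ] ys ⊆ xs × Unique ys × AllPairs (λ x y → ¬ R x y) ys × b ≤ length ys

  ramsey : ∀ a b {xs} → Unique xs → ramseyBound a b ≤ length xs → Clique≥ a xs ⊎ Stable≥ b xs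
  ramsey zero b _ _ = inj₁ ([] , (λ ()) , [] , z≤n)
  ramsey (suc a) zero _ _ = inj₂ ([] , (λ ()) , [] , [] , z≤n)
  ramsey (suc a) (suc b) {x ∷ xs} (x∉xs ∷ xs!) (s≤s le)
    with +-≤-split (≤-trans le (length-filter-∁ (R? x) xs))
  ... | inj₁ leᴬ with ramsey a (suc b) (Unique.filter⁺ (R? x) xs!) leᴬ
  ...   | inj₁ (ys , ys⊆ , clique , len) = inj₁
    ( x ∷ ys
    , (λ { (here refl) → here refl ; (there y∈) → there (proj₁ (∈-filter⁻ (R? x) (ys⊆ y∈))) })
    , All.tabulate (proj₂ ∘ ∈-filter⁻ (R? x) {xs = xs} ∘ ys⊆) ∷ clique
    , s≤s len )
  ...   | inj₂ (ys , ys⊆ , rest) = inj₂ (ys , there ∘ proj₁ ∘ ∈-filter⁻ (R? x) ∘ ys⊆ , rest)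
  ramsey (suc a) (suc b) {x ∷ xs} (x∉xs ∷ xs!) (s≤s le)
      | inj₂ leᴮ with ramsey (suc a) b (Unique.filter⁺ (¬? ∘ R? x) xs!) leᴮ
  ...   | inj₁ (ys , ys⊆ , rest) = inj₁ (ys , there ∘ proj₁ ∘ ∈-filter⁻ (¬? ∘ R? x) ∘ ys⊆ , rest)
  ...   | inj₂ (ys , ys⊆ , ys! , stable , len) = inj₂
    ( x ∷ ys
    , (λ { (here refl) → here refl ; (there y∈) → there (proj₁ (∈-filter⁻ (¬? ∘ R? x) (ys⊆ y∈))) })
    , All.tabulate (All.lookup x∉xs ∘ proj₁ ∘ ∈-filter⁻ (¬? ∘ R? x) ∘ ys⊆) ∷ ys!
    , All.tabulate (proj₂ ∘ ∈-filter⁻ (¬? ∘ R? x) {xs = xs} ∘ ys⊆) ∷ stable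
    , s≤s len )

-- Numbering the entries of a list, for the renaming of colours.

-- nth returns 0 out of range.
position nth : List ℕ → ℕ → ℕ
position []       a = 0
position (x ∷ xs) a with x ℕ.≟ a
... | yes _ = 0
... | no  _ = suc (position xs a)
nth []       i       = 0
nth (x ∷ xs) zero    = x
nth (x ∷ xs) (suc i) = nth xs i

position<length : ∀ {xs a} → a ∈ xs → position xs a < length xs
position<length {x ∷ xs} {a} a∈ with x ℕ.≟ a | a∈
... | yes _   | _         = z<s
... | no x≢a  | here a≡x  = contradiction (≡-sym a≡x) x≢a
... | no _    | there a∈′ = s<s (position<length a∈′)

nth-position : ∀ {xs a} → a ∈ xs → nth xs (position xs a) ≡ a
nth-position {x ∷ xs} {a} a∈ with x ℕ.≟ a | a∈
... | yes x≡a | _         = x≡a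
... | no x≢a  | here a≡x  = contradiction (≡-sym a≡x) x≢a
... | no _    | there a∈′ = nth-position a∈′

nth∈ : ∀ {xs i} → i < length xs → nth xs i ∈ xs
nth∈ {x ∷ xs} {zero}  _         = here refl
nth∈ {x ∷ xs} {suc i} (s<s i<l) = there (nth∈ i<l)

nth-injective : ∀ {xs i j} → Unique xs → i < length xs → j < length xs →
  nth xs i ≡ nth xs j → i ≡ j
nth-injective {x ∷ xs} {zero} {zero} _ _ _ _ = refl
nth-injective {x ∷ xs} {zero} {suc j} (x∉xs ∷ _) _ (s<s j<l) eq =
  contradiction eq (All.lookup x∉xs (nth∈ j<l))
nth-injective {x ∷ xs} {suc i} {zero} (x∉xs ∷ _) (s<s i<l) _ eq =
  contradiction (≡-sym eq) (All.lookup x∉xs (nth∈ i<l))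
nth-injective {x ∷ xs} {suc i} {suc j} (_ ∷ xs!) (s<s i<l) (s<s j<l) eq =
  cong suc (nth-injective xs! i<l j<l eq)

-- Recognising induced subgraphs pair by pair.

-- The nested product lets the requirements on a small concrete graph be given as a tuple with one
-- row per vertex, each unordered pair being treated once.
UpperPairs : (m : ℕ) → (Fin m → Fin m → Set) → Set
UpperPairs zero    P = ⊤
UpperPairs (suc m) P = (∀ j → P zero (suc j)) × UpperPairs m (λ i j → P (suc i) (suc j))

upperPairs-lookup : ∀ {m} {P : Fin m → Fin m → Set} → UpperPairs m P →
  ∀ i j → i ≡ j ⊎ P i j ⊎ P j i
upperPairs-lookup _       zero    zero    = inj₁ refl
upperPairs-lookup (p , _) zero    (suc j) = inj₂ (inj₁ (p j))
upperPairs-lookup (p , _) (suc i) zero    = inj₂ (inj₂ (p i))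
upperPairs-lookup (_ , q) (suc i) (suc j) = Sum.map₁ (cong suc) (upperPairs-lookup q i j)

-- suc k + suc k bounds the number of deletions made by prune.
independentBound degreeBound : ℕ → ℕ → ℕ
independentBound k N = suc (suc k + suc k) + (2 + N)
degreeBound k N = ramseyBound (2 + k) (independentBound k N)

-- The maximum keeps the earlier bounds in force, so that `sizeBound k` serves every `Critical m`
-- with `m < k`. The cube bounds a ball of radius three.
sizeBound : ℕ → ℕ
sizeBound zero    = 0
sizeBound (suc k) = sizeBound k ⊔ suc (degreeBound k (sizeBound k)) ^ 3

-- Forbidden induced subgraphs.

module _ {n : ℕ} (G : Graph n) where

  infix 4 _~_ _≁_
  _~_ _≁_ : Fin n → Fin n → Set
  u ~ v = Adj G u v
  u ≁ v = ¬ u ~ v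

  ~⇒≢ : ∀ {u v} → u ~ v → u ≢ v
  ~⇒≢ u~u refl = irrefl G _ u~u

  module _ {m : ℕ} (F : Graph m) (f : Fin m → Fin n) where

    -- For a concrete `F` the test computes, so each pair asks for exactly one alternative.
    -- Distinctness is asked for only where no edge provides it.
    Realises : Fin m → Fin m → Set
    Realises i j = if does (adj? F i j) then f i ~ f j else (f i ≁ f j × f i ≢ f j)

    private
      realises⇒⇔ : ∀ i j → Realises i j →
        (Adj F i j → f i ~ f j) × (f i ~ f j → Adj F i j) × f i ≢ f j
      realises⇒⇔ i j r with adj? F i j
      ... | yes a = (λ _ → r) , (λ _ → a) , ~⇒≢ r
      ... | no ¬a = (λ a → contradiction a ¬a) , (λ r′ → contradiction r′ (proj₁ r)) , proj₂ r

    realises⇒⊑ : UpperPairs m Realises → F ⊑ G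
    realises⇒⊑ r = record
      { embedding = mk↣ (λ {i} {j} → injective i j)
      ; adj-⇔ = λ i j → mk⇔ (proj₁ (preserves i j)) (proj₂ (preserves i j))
      }
      where
      injective : ∀ i j → f i ≡ f j → i ≡ j
      injective i j fi≡fj with upperPairs-lookup r i j
      ... | inj₁ i≡j = i≡j
      ... | inj₂ (inj₁ p) = contradiction fi≡fj (proj₂ (proj₂ (realises⇒⇔ i j p)))
      ... | inj₂ (inj₂ p) = contradiction (≡-sym fi≡fj) (proj₂ (proj₂ (realises⇒⇔ j i p)))
      preserves : ∀ i j → (Adj F i j → f i ~ f j) × (f i ~ f j → Adj F i j)
      preserves i j with upperPairs-lookup r i j
      ... | inj₁ refl = (λ a → contradiction a (irrefl F i)) , λ a → contradiction a (irrefl G (f i))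
      ... | inj₂ (inj₁ p) with realises⇒⇔ i j p
      ...   | ⇒ , ⇐ , _ = ⇒ , ⇐
      preserves i j | inj₂ (inj₂ p) with realises⇒⇔ j i p
      ...   | ⇒ , ⇐ , _ = sym G ∘ ⇒ ∘ sym F , sym F ∘ ⇐ ∘ sym G

  -- No distinctness has to be assumed: identifying two non-consecutive vertices would turn an edge
  -- of the path into one of the excluded adjacencies.
  no-P₅ : ¬ (P₅ ⊑ G) → ∀ {a b c d e} → a ~ b → b ~ c → c ~ d → d ~ e →
    a ≁ c → a ≁ d → a ≁ e → b ≁ d → b ≁ e → c ≁ e → ⊥
  no-P₅ P₅-free {a} {b} {c} {d} {e} ab bc cd de ac ad ae bd be ce =
    P₅-free (realises⇒⊑ P₅ (Vec.lookup (a ∷ b ∷ c ∷ d ∷ e ∷ []))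
      ( (λ { zero → ab ; (suc zero) → ac , λ { refl → ad cd }
           ; (suc (suc zero)) → ad , λ { refl → ae de }
           ; (suc (suc (suc zero))) → ae , λ { refl → ad (sym G de) } })
      , (λ { zero → bc ; (suc zero) → bd , λ { refl → ad ab }
           ; (suc (suc zero)) → be , λ { refl → ae ab } })
      , (λ { zero → cd ; (suc zero) → ce , λ { refl → be bc } })
      , (λ { zero → de })
      , (λ ())
      , _))

  -- The chair with claw centre z, leaves u, v, s, and pendant x at s.
  no-chair : ¬ (chair ⊑ G) → ∀ {z u v s x} → z ~ u → z ~ v → z ~ s → x ~ s →
    u ≢ v → u ≁ v → u ≁ s → v ≁ s → x ≁ u → x ≁ v → x ≁ z → ⊥
  no-chair chair-free {z} {u} {v} {s} {x} zu zv zs xs u≢v uv us vs xu xv xz =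
    -- The pendant vertex of `addPendant` is `u`, and the path on four vertices is `v`, `z`, `s`,
    -- `x`. Only `u` and `v` have the same neighbours in the chair, so only their distinctness must
    -- be assumed.
    chair-free (realises⇒⊑ chair (Vec.lookup (u ∷ v ∷ z ∷ s ∷ x ∷ []))
      ( (λ { zero → uv , u≢v ; (suc zero) → sym G zu
           ; (suc (suc zero)) → us , λ { refl → xu xs }
           ; (suc (suc (suc zero))) → xu ∘ sym G , λ { refl → xz (sym G zu) } })
      , (λ { zero → sym G zv ; (suc zero) → vs , λ { refl → xv xs }
           ; (suc (suc zero)) → xv ∘ sym G , λ { refl → xz (sym G zv) } })
      , (λ { zero → zs ; (suc zero) → xz ∘ sym G , λ { refl → xu zu } })
      , (λ { zero → sym G xs })
      , (λ ())
      , _))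

  -- Colourings and criticality of vertex subsets.

  Subset : Set₁
  Subset = Pred (Fin n) 0ℓ

  infixl 6 _∖_
  _∖_ : Subset → Fin n → Subset
  (W ∖ v) u = W u × u ≢ v

  -- Colours are natural numbers bounded on `W` only, so values elsewhere are arbitrary and one
  -- function can be reused on other subsets.
  Col : ℕ → Subset → Set
  Col k W = Σ[ c ∈ (Fin n → ℕ) ]
    (∀ {u} → W u → c u < k) × (∀ {u v} → W u → W v → u ~ v → c u ≢ c v)

  -- W induces a (k + 1)-vertex-critical subgraph.
  Critical : ℕ → Subset → Set
  Critical k W = ¬ Col k W × (∀ {v} → W v → Col k (W ∖ v))

  Col-⊆ : ∀ {k} {W W′ : Subset} → (∀ {u} → W u → W′ u) → Col k W′ → Col k W
  Col-⊆ W⊆W′ (c , c< , proper) = c , c< ∘ W⊆W′ , λ u v → proper (W⊆W′ u) (W⊆W′ v)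

  Col-≤ : ∀ {k k′ W} → k ≤ k′ → Col k W → Col k′ W
  Col-≤ k≤k′ (c , c< , proper) = c , (λ w → ≤-trans (c< w) k≤k′) , proper

  Col? : ∀ {k W} → Decidable W → Dec (Col k W)
  Col? {k} {W} W? = map′ from to (any? λ i → colours? (finToFun i))
    where
    -- The codomain is `Fin (suc k)` because vertices outside `W` need a value even when `k` is 0;
    -- truncation at `k` changes nothing on `W`.
    Colours : (Fin n → Fin (suc k)) → Set
    Colours f = (∀ u → W u → toℕ (f u) < k) × (∀ u v → W u × W v × u ~ v → f u ≢ f v)
    colours? : Decidable Colours
    colours? f = all? (λ u → W? u →-dec toℕ (f u) <? k) ×-dec
      all? (λ u → all? λ v → (W? u ×-dec W? v ×-dec adj? G u v) →-dec ¬? (f u ≟ f v))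
    from : ∃ (Colours ∘ finToFun) → Col k W
    from (i , c< , proper) = toℕ ∘ finToFun i , c< _ ,
      λ u v uv eq → proper _ _ (u , v , uv) (toℕ-injective eq)
    to : Col k W → ∃ (Colours ∘ finToFun)
    to (c , c< , proper) = funToFin f ,
      (λ u Wu → subst (_< k) (≡-sym (f-toℕ Wu)) (c< Wu)) ,
      λ u v (Wu , Wv , uv) eq → proper Wu Wv uv
        (trans (≡-sym (f-toℕ Wu)) (trans (cong toℕ eq) (f-toℕ Wv)))
      where
      f : Fin n → Fin (suc k)
      f u = fromℕ< (s≤s (m⊓n≤n (c u) k))
      f-toℕ : ∀ {u} → W u → toℕ (finToFun (funToFin f) u) ≡ c u
      f-toℕ {u} Wu = trans (cong toℕ (finToFun-funToFin f u))
        (trans (toℕ-fromℕ< (s≤s (m⊓n≤n (c u) k))) (m≤n⇒m⊓n≡m (<⇒≤ (c< Wu))))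

  -- The colour `k` is still free for the deleted vertex.
  critical⇒Col : ∀ {k W} → Critical k W → ∀ {v} → W v → Col (suc k) W
  critical⇒Col {k} {W} (_ , crit) {v} Wv with crit Wv
  ... | c , c< , proper = c′ , c′< , proper′
    where
    c′ : Fin n → ℕ
    c′ u = if does (u ≟ v) then k else c u
    c′< : ∀ {u} → W u → c′ u < suc k
    c′< {u} Wu with u ≟ v
    ... | yes _  = n<1+n k
    ... | no u≢v = m<n⇒m<1+n (c< (Wu , u≢v))
    proper′ : ∀ {u w} → W u → W w → u ~ w → c′ u ≢ c′ w
    proper′ {u} {w} Wu Ww uw with u ≟ v | w ≟ v
    ... | yes refl | yes refl = contradiction uw (irrefl G v)
    ... | yes refl | no w≢v = (<⇒≢ (c< (Ww , w≢v))) ∘ ≡-sym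
    ... | no u≢v | yes refl = <⇒≢ (c< (Wu , u≢v))
    ... | no u≢v | no w≢v = proper (Wu , u≢v) (Ww , w≢v) uw

  critical⇒nonempty : ∀ {k W} → Decidable W → Critical k W → ∃ W
  critical⇒nonempty {k} {W} W? (¬col , _) with any? W?
  ... | yes w = w
  ... | no ∄w = ⊥-elim (¬col
    ((λ _ → 0) , (λ Wu → contradiction (_ , Wu) ∄w) , λ Wu → contradiction (_ , Wu) ∄w))

  clique≤ : ∀ {k W} → Col k W → ∀ {C} → All W C → AllPairs _~_ C → length C ≤ k
  clique≤ {k} {W} (c , c< , proper) {C} WC clique =
    subst₂ _≤_ (length-map c C) (length-upTo k)
      (unique-⊆⇒length≤ ℕ._≟_ (AllPairs.map⁺ (distinct WC clique)) colour<)
    where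
    distinct : ∀ {C} → All W C → AllPairs _~_ C → AllPairs (λ u v → c u ≢ c v) C
    distinct [] [] = []
    distinct (Wu ∷ WC) (u~C ∷ clique) =
      All.zipWith (λ (Wv , uv) → proper Wu Wv uv) (WC , u~C) ∷ distinct WC clique
    colour< : ∀ {x} → x ∈ map c C → x ∈ upTo k
    colour< x∈ with ∈-map⁻ c x∈
    ... | u , u∈C , refl = ∈-upTo⁺ (c< (All.lookup WC u∈C))

  -- Otherwise a colouring that omits `v` can be used inside `B` and one that omits `u` outside. No
  -- edge of `W` leaves `B`, so together they colour `W` with `k` colours.
  critical-connected : ∀ {k W} {B : Subset} → Decidable B → Critical k W →
    (∀ {u v} → B u → W v → u ~ v → B v) → ∀ {u} → W u → B u → ∀ {v} → W v → B v
  critical-connected {k} {W} {B} B? (¬col , crit) closed {u} Wu Bu {v} Wv with B? v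
  ... | yes Bv = Bv
  ... | no ¬Bv with crit Wv | crit Wu
  ...   | c , c< , proper | d , d< , proper′ = ⊥-elim (¬col (e , e< , proper″))
    where
    ¬Bu : ∀ {w} → B w → w ≢ v
    ¬Bu Bw refl = ¬Bv Bw
    Bv′ : ∀ {w} → ¬ B w → w ≢ u
    Bv′ ¬Bw refl = ¬Bw Bu
    e : Fin n → ℕ
    e w = if does (B? w) then c w else d w
    e< : ∀ {w} → W w → e w < k
    e< {w} Ww with B? w
    ... | yes Bw = c< (Ww , ¬Bu Bw)
    ... | no ¬Bw = d< (Ww , Bv′ ¬Bw)
    proper″ : ∀ {w x} → W w → W x → w ~ x → e w ≢ e x
    proper″ {w} {x} Ww Wx wx with B? w | B? x
    ... | yes Bw | yes Bx = proper (Ww , ¬Bu Bw) (Wx , ¬Bu Bx) wx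
    ... | yes Bw | no ¬Bx = contradiction (closed Bw Wx wx) ¬Bx
    ... | no ¬Bw | yes Bx = contradiction (closed Bx Ww (sym G wx)) ¬Bw
    ... | no ¬Bw | no ¬Bx = proper′ (Ww , Bv′ ¬Bw) (Wx , Bv′ ¬Bx) wx

  -- Modules of critical graphs.

  -- Here `suc m` is the chromatic number of `M`, reached by lowering the number of colours while a
  -- colouring exists; a vertex of `M` stops the descent before zero.
  Col-threshold : ∀ {M : Subset} → Decidable M → ∃ M → ∀ k → Col k M →
    ∃[ m ] m < k × ¬ Col m M × Col (suc m) M
  Col-threshold M? (_ , Mu) zero (c , c< , _) = contradiction (c< Mu) λ ()
  Col-threshold M? M≠∅ (suc k) col with Col? {k} M?
  ... | no ¬col = k , n<1+n k , ¬col , col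
  ... | yes col′ with Col-threshold M? M≠∅ k col′
  ...   | m , m<k , rest = m , m<n⇒m<1+n m<k , rest

  Module : Subset → Subset → Set
  Module W M = ∀ {w x y} → W w → ¬ M w → M x → M y → w ~ x → w ~ y

  -- If deleting v left the chromatic number of M unchanged, a colouring of
  -- W ∖ v would use enough colours on M ∖ v to recolour all of M with them.
  module-critical : ∀ {k} {W M : Subset} → Decidable M → (∀ {u} → M u → W u) → Module W M →
    Critical k W → ∃ M → Col k M → ∃[ m ] m < k × Critical m M
  module-critical {k} {W} {M} M? M⊆W modular (¬colW , crit) M≠∅ colM
    with Col-threshold M? M≠∅ k colM
  ... | m , m<k , ¬col , (d , d< , d-proper) = m , m<k , ¬col , critM
    where
    critM : ∀ {v} → M v → Col m (M ∖ v)
    critM {v} Mv with crit (M⊆W Mv)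
    ... | c , c< , proper = go (length used ≤? m)
      where
      isUsed : Decidable (λ i → ∃[ x ] (M ∖ v) x × c x ≡ i)
      isUsed i = any? λ x → (M? x ×-dec ¬? (x ≟ v)) ×-dec (c x ℕ.≟ i)
      used : List ℕ
      used = filter isUsed (upTo k)
      used! : Unique used
      used! = Unique.filter⁺ isUsed (Unique.upTo⁺ k)
      W∖v : ∀ {u} → (M ∖ v) u → (W ∖ v) u
      W∖v (Mu , u≢v) = M⊆W Mu , u≢v
      c∈used : ∀ {u} → (M ∖ v) u → c u ∈ used
      c∈used {u} Mu = ∈-filter⁺ isUsed (∈-upTo⁺ (c< (W∖v Mu))) (u , Mu , refl)
      go : Dec (length used ≤ m) → Col m (M ∖ v)
      -- Few colours occur on `M` without `v`: rename each to its position in `used`.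
      go (yes le) = position used ∘ c ,
        (λ Mu → <-≤-trans (position<length (c∈used Mu)) le) ,
        λ Mu Mw uw eq → proper (W∖v Mu) (W∖v Mw) uw
          (trans (≡-sym (nth-position (c∈used Mu)))
            (trans (cong (nth used) eq) (nth-position (c∈used Mw))))
      -- At least `suc m` colours occur, enough to rename those of `d`; the rest of `W` keeps its
      -- colours from `c`.
      go (no ≰m) = ⊥-elim (¬colW (e , e< , e-proper))
        where
        d<′ : ∀ {u} → M u → d u < length used
        d<′ Mu = <-≤-trans (d< Mu) (≰⇒> ≰m)
        nth-used : ∀ {u} → M u → ∃[ x ] (M ∖ v) x × c x ≡ nth used (d u)
        nth-used Mu = proj₂ (∈-filter⁻ isUsed {xs = upTo k} (nth∈ (d<′ Mu)))
        e : Fin n → ℕ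
        e u = if does (M? u) then nth used (d u) else c u
        ≢v : ∀ {u} → ¬ M u → u ≢ v
        ≢v ¬Mu refl = ¬Mu Mv
        e< : ∀ {u} → W u → e u < k
        e< {u} Wu with M? u
        ... | yes Mu = ∈-upTo⁻ (proj₁ (∈-filter⁻ isUsed (nth∈ (d<′ Mu))))
        ... | no ¬Mu = c< (Wu , ≢v ¬Mu)
        -- The colour given to `u` is the colour under `c` of some `x` in `M` other than `v`, and by
        -- modularity `w` is adjacent to `x` as well.
        mixed : ∀ {u w} → M u → W w → ¬ M w → w ~ u → c w ≢ nth used (d u)
        mixed Mu Ww ¬Mw wu eq with nth-used Mu
        ... | x , Mx , cx≡ = proper (Ww , ≢v ¬Mw) (W∖v Mx)
          (modular Ww ¬Mw Mu (proj₁ Mx) wu) (trans eq (≡-sym cx≡))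
        e-proper : ∀ {u w} → W u → W w → u ~ w → e u ≢ e w
        e-proper {u} {w} Wu Ww uw with M? u | M? w
        ... | yes Mu | yes Mw = d-proper Mu Mw uw ∘ nth-injective used! (d<′ Mu) (d<′ Mw)
        ... | yes Mu | no ¬Mw = mixed Mu Ww ¬Mw (sym G uw) ∘ ≡-sym
        ... | no ¬Mu | yes Mw = mixed Mw Wu ¬Mu uw
        ... | no ¬Mu | no ¬Mw = proper (Wu , ≢v ¬Mu) (Ww , ≢v ¬Mw) uw

  -- Stable sets, their defects, and hulls.

  Independent : List (Fin n) → Set
  Independent T = ∀ {s t} → s ∈ T → t ∈ T → s ≁ t

  remove : List (Fin n) → Fin n → List (Fin n)
  remove T v = filter (λ t → ¬? (t ≟ v)) T

  ∈-remove⁺ : ∀ {T v t} → t ∈ T → t ≢ v → t ∈ remove T v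
  ∈-remove⁺ = ∈-filter⁺ _

  ∈-remove⁻ : ∀ {T v t} → t ∈ remove T v → t ∈ T × t ≢ v
  ∈-remove⁻ = ∈-filter⁻ _

  length-remove : ∀ {T} v → Unique T → length T ≤ suc (length (remove T v))
  length-remove {T} v T! = unique-⊆⇒length≤ _≟_ {ys = v ∷ remove T v} T! keep
    where
    keep : T ⊆ v ∷ remove T v
    keep {t} t∈T with t ≟ v
    ... | yes refl = here refl
    ... | no t≢v = there (∈-remove⁺ t∈T t≢v)

  NoDefect : Subset → List (Fin n) → Set
  NoDefect W T = ∀ {y v} → W y → v ∈ T → y ≁ v → ¬ All (y ~_) (remove T v)

  -- Records one deletion by `prune`: `v` is deleted because `y` misses it alone, and `rest` is the
  -- stable set left right after the deletion.
  record Defect : Set where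
    constructor defect
    field
      y v         : Fin n
      rest        : List (Fin n)
      y≁v         : y ≁ v
      y~rest      : All (y ~_) rest
      v∉rest      : v ∉ rest
      independent : Independent (v ∷ rest)

  open Defect

  defect? : ∀ {W} → Decidable W → ∀ T → NoDefect W T ⊎
    ∃[ y ] ∃[ v ] W y × v ∈ T × y ≁ v × All (y ~_) (remove T v)
  defect? W? T with any? (λ y → any? λ v →
      W? y ×-dec (v ∈? T) ×-dec ¬? (adj? G y v) ×-dec All.all? (adj? G y) (remove T v))
    where open DecMembership {A = Fin n} _≟_ using (_∈?_)
  ... | yes found = inj₂ found
  ... | no none = inj₁ λ {y} {v} Wy v∈T y≁v y~ → none (y , v , Wy , v∈T , y≁v , y~)

  Chain : Subset → List (Fin n) → List Defect → Set
  Chain W T C = AllPairs (λ p q → y p ~ y q) C × All (λ p → W (y p) × T ⊆ rest p) C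

  -- Of two deletions, the later removes a vertex that survived the earlier. The disjunction leaves
  -- open which of the two came later.
  Cross : List Defect → List Defect → Set
  Cross C D = ∀ {p q} → p ∈ C → q ∈ D → v p ∈ rest q ⊎ v q ∈ rest p

  chain≤ : ∀ {K W T C} → Col K W → Chain W T C → length C ≤ K
  chain≤ {C = C} col (pairs , all) = subst (_≤ _) (length-map y C)
    (clique≤ col (All.map⁺ (All.map proj₁ all)) (AllPairs.map⁺ pairs))

  Dominates : Fin n → List (Fin n) → Set
  Dominates z T = All (z ~_) T

  -- This is the module `M` of the opening outline, taken inside `W`; the vertices `z` make up its
  -- set `Z`.
  hull : Subset → List (Fin n) → Subset
  hull W T x = W x × ¬ Dominates x T × (∀ z → W z → Dominates z T → z ~ x)

  hull? : ∀ {W} → Decidable W → ∀ T → Decidable (hull W T)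
  hull? W? T x = W? x ×-dec ¬? (All.all? (adj? G x) T) ×-dec
    all? λ z → W? z →-dec All.all? (adj? G z) T →-dec adj? G z x

  Size≤ : Subset → ℕ → Set
  Size≤ W N = ∀ {xs} → Unique xs → All W xs → length xs ≤ N

  independent⁺ : ∀ {T} → AllPairs _≁_ T → Independent T
  independent⁺ (_ ∷ _)   (here refl) (here refl) = irrefl G _
  independent⁺ (x≁ ∷ _)  (here refl) (there t∈)  = All.lookup x≁ t∈
  independent⁺ (x≁ ∷ _)  (there s∈)  (here refl) = All.lookup x≁ s∈ ∘ sym G
  independent⁺ (_ ∷ T≁)  (there s∈)  (there t∈)  = independent⁺ T≁ s∈ t∈

  -- Pruning a stable set until no defect remains.

  module _ (P₅-free : ¬ (P₅ ⊑ G)) (chair-free : ¬ (chair ⊑ G)) where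

    -- If `y` met the `v` of `p`, the path from that vertex through `y`, `s` and the `y` of `p` to
    -- the new `v` would be an induced P₅. If `y` missed a further `u`, the claw at the `y` of `p`
    -- with leaves `u`, `v`, `s` would become a chair with `y` pendant at `s`.
    defects-nonadjacent : ∀ {T y v s} (p : Defect) → T ⊆ rest p → v ∈ T → y ≁ v →
      All (y ~_) (remove T v) → s ∈ remove T v → y ≁ Defect.y p →
      y ≁ Defect.v p × (∀ {u} → u ∈ rest p → u ≢ v → y ~ u)
    defects-nonadjacent {T} {y} {v} {s} p T⊆ v∈T y≁v y~ s∈ y≁yₚ = misses-vₚ , meets-rest
      where
      y~s : y ~ s
      y~s = All.lookup y~ s∈
      s∈p : s ∈ rest p
      s∈p = T⊆ (proj₁ (∈-remove⁻ s∈))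
      v∈p : v ∈ rest p
      v∈p = T⊆ v∈T
      yₚ~ : ∀ {t} → t ∈ rest p → Defect.y p ~ t
      yₚ~ = All.lookup (y~rest p)
      misses-vₚ : y ≁ Defect.v p
      misses-vₚ y~vₚ = no-P₅ P₅-free (sym G y~vₚ) y~s (sym G (yₚ~ s∈p)) (yₚ~ v∈p)
        (independent p (here refl) (there s∈p)) (Defect.y≁v p ∘ sym G)
        (independent p (here refl) (there v∈p))
        y≁yₚ y≁v (independent p (there s∈p) (there v∈p))
      meets-rest : ∀ {u} → u ∈ rest p → u ≢ v → y ~ u
      meets-rest {u} u∈ u≢v = decidable-stable (adj? G y u) λ y≁u →
        no-chair chair-free (yₚ~ u∈) (yₚ~ v∈p) (yₚ~ s∈p) y~s u≢v
          (independent p (there u∈) (there v∈p)) (independent p (there u∈) (there s∈p))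
          (independent p (there v∈p) (there s∈p)) y≁u y≁v y≁yₚ

    -- The vertex y of a new defect is nonadjacent to the y of at most one earlier
    -- defect, so the vertices y of all defects split into two cliques C and D.
    -- At most g further deletions are made.
    prune : ∀ {K W} → Decidable W → Col K W → ∀ N g {T C D} →
      Unique T → Independent T → Chain W T C → Chain W T D → Cross C D →
      g + (2 + N) ≤ length T → K + K < g + (length C + length D) →
      ∃[ T′ ] T′ ⊆ T × Unique T′ × NoDefect W T′ × N < length T′
    -- With no deletions left there are more than `K + K` defects, although each of the two cliques
    -- has at most `K`.
    prune W? col N zero T! ind chC chD cross _ K< =
      contradiction (+-mono-≤ (chain≤ col chC) (chain≤ col chD)) (<⇒≱ K<)
    prune {K} {W} W? col N (suc g) {T} {C} {D} T! ind chC@(pC , aC) chD@(pD , aD) cross T≥ K<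
      with defect? W? T
    ... | inj₁ none = T , id , T! , none ,
      m+n≤o⇒n≤o (suc (suc g)) (subst (_≤ length T) (cong suc (+-suc g (suc N))) T≥)
    ... | inj₂ (y₀ , v₀ , Wy , v∈T , y≁v , y~) = go (All.all? near? C) (All.all? near? D)
      where
      T′ = remove T v₀
      near? : Decidable (λ p → y₀ ~ y p)
      near? p = adj? G y₀ (y p)
      T′≥ : g + (2 + N) ≤ length T′
      T′≥ = s≤s⁻¹ (≤-trans T≥ (length-remove v₀ T!))
      T′-ind : Independent T′
      T′-ind s∈ t∈ = ind (proj₁ (∈-remove⁻ s∈)) (proj₁ (∈-remove⁻ t∈))
      new : Defect
      new = defect y₀ v₀ T′ y≁v y~ (λ v∈ → proj₂ (∈-remove⁻ {T} v∈) refl)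
        (λ s∈ t∈ → ind (inT s∈) (inT t∈))
        where
        inT : ∀ {t} → t ∈ v₀ ∷ T′ → t ∈ T
        inT (here refl) = v∈T
        inT (there t∈) = proj₁ (∈-remove⁻ t∈)
      weaken : ∀ {C} → All (λ p → W (y p) × T ⊆ rest p) C →
        All (λ p → W (y p) × T′ ⊆ rest p) C
      weaken = All.map λ (Wy , T⊆) → Wy , T⊆ ∘ proj₁ ∘ ∈-remove⁻
      extend : ∀ {C} → Chain W T C → All (λ p → y₀ ~ y p) C → Chain W T′ (new ∷ C)
      extend (pC , aC) near = near ∷ pC , (Wy , id) ∷ weaken aC
      go : Dec (All (λ p → y₀ ~ y p) C) → Dec (All (λ p → y₀ ~ y p) D) →
        ∃[ T″ ] T″ ⊆ T × Unique T″ × NoDefect W T″ × N < length T″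
      go (yes nearC) _
        with prune W? col N g (Unique.filter⁺ _ T!) T′-ind
          (extend chC nearC) (pD , weaken aD)
          (λ { (here refl) q∈ → inj₁ (proj₂ (All.lookup aD q∈) v∈T)
             ; (there p∈) q∈ → cross p∈ q∈ })
          T′≥ (subst (K + K <_) (≡-sym (+-suc g _)) K<)
      ... | T″ , ⊆T′ , rest′ = T″ , proj₁ ∘ ∈-remove⁻ ∘ ⊆T′ , rest′
      go (no _) (yes nearD)
        with prune W? col N g {C = C} {D = new ∷ D} (Unique.filter⁺ _ T!) T′-ind
          (pC , weaken aC) (extend chD nearD)
          (λ { p∈ (here refl) → inj₂ (proj₂ (All.lookup aC p∈) v∈T)
             ; p∈ (there q∈) → cross p∈ q∈ })
          T′≥ (subst (K + K <_)
            (trans (≡-sym (+-suc g _)) (cong (g +_) (≡-sym (+-suc (length C) (length D))))) K<)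
      ... | T″ , ⊆T′ , rest′ = T″ , proj₁ ∘ ∈-remove⁻ ∘ ⊆T′ , rest′
      -- Say `v p ∈ rest q`. Being nonadjacent to `y p`, the new `y₀` misses `v p`; being
      -- nonadjacent to `y q`, it meets `v p`. The other case is symmetric.
      go (no farC) (no farD) with find (¬All⇒Any¬ near? C farC) | find (¬All⇒Any¬ near? D farD)
      ... | p , p∈ , y≁p | q , q∈ , y≁q = ⊥-elim (impossible (cross p∈ q∈))
        where
        T⊆p = proj₂ (All.lookup aC p∈)
        T⊆q = proj₂ (All.lookup aD q∈)
        nonempty : ∀ {xs : List (Fin n)} → 0 < length xs → ∃[ s ] s ∈ xs
        nonempty {s ∷ _} _ = s , here refl
        -- The summand `2 + N` keeps `T′` nonempty.
        s∈ = proj₂ (nonempty (≤-trans z<s (m+n≤o⇒n≤o g T′≥)))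
        at-p = defects-nonadjacent p T⊆p v∈T y≁v y~ s∈ y≁p
        at-q = defects-nonadjacent q T⊆q v∈T y≁v y~ s∈ y≁q
        differs : ∀ r → T ⊆ rest r → v r ≢ v₀
        differs r T⊆r refl = v∉rest r (T⊆r v∈T)
        impossible : v p ∈ rest q ⊎ v q ∈ rest p → ⊥
        impossible (inj₁ vp∈q) = proj₁ at-p (proj₂ at-q vp∈q (differs p T⊆p))
        impossible (inj₂ vq∈p) = proj₁ at-q (proj₂ at-p vq∈p (differs q T⊆q))

    -- The hull of a stable set without defects.

    module _ {W T} (W? : Decidable W) (T⊆W : All W T)
             (independent : Independent T) (none : NoDefect W T) where

      -- If the nonneighbour that exists were the only one, `x` would be a defect.
      two-nonneighbours : ∀ {x} → W x → ¬ Dominates x T →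
        ∃[ t ] ∃[ t′ ] t ∈ T × t′ ∈ T × t ≢ t′ × x ≁ t × x ≁ t′
      two-nonneighbours {x} Wx ¬dom with find (¬All⇒Any¬ (adj? G x) T ¬dom)
      ... | t , t∈ , x≁t with find (¬All⇒Any¬ (adj? G x) (remove T t) (none Wx t∈ x≁t))
      ...   | t′ , t′∈ , x≁t′ with ∈-remove⁻ t′∈
      ...     | t′∈T , t′≢t = t , t′ , t∈ , t′∈T , t′≢t ∘ ≡-sym , x≁t , x≁t′

      -- Suppose some `z` complete to `T` missed `w`. If `w` has a neighbour `s` in `T`, then `s`
      -- and two nonneighbours of `w` in `T` form a claw at `z`, and `w` is pendant at `s`. If not,
      -- `x` and two nonneighbours of `x` in `T` form the claw, and `w` is pendant at `x`. Either
      -- way there is a chair.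
      hull-closed : ∀ {w x} → W w → ¬ Dominates w T → hull W T x → w ~ x → hull W T w
      hull-closed {w} {x} Ww ¬dom (Wx , ¬dom-x , z~x) w~x = Ww , ¬dom , z~w
        where
        z~w : ∀ z → W z → Dominates z T → z ~ w
        z~w z Wz z~T
          with two-nonneighbours Ww ¬dom | two-nonneighbours Wx ¬dom-x | Any.any? (adj? G w) T
        ... | t , t′ , t∈ , t′∈ , t≢t′ , w≁t , w≁t′ | _ | yes hit =
          decidable-stable (adj? G z w) λ z≁w →
          let s , s∈ , w~s = find hit in
          no-chair chair-free (All.lookup z~T t∈) (All.lookup z~T t′∈) (All.lookup z~T s∈)
            w~s t≢t′ (independent t∈ t′∈) (independent t∈ s∈) (independent t′∈ s∈)
            w≁t w≁t′ (z≁w ∘ sym G)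
        ... | _ | t , t′ , t∈ , t′∈ , t≢t′ , x≁t , x≁t′ | no miss =
          decidable-stable (adj? G z w) λ z≁w →
          no-chair chair-free (All.lookup z~T t∈) (All.lookup z~T t′∈) (z~x z Wz z~T) w~x t≢t′
            (independent t∈ t′∈) (x≁t ∘ sym G) (x≁t′ ∘ sym G)
            (All.lookup w≁T t∈) (All.lookup w≁T t′∈) (z≁w ∘ sym G)
          where w≁T = ¬Any⇒All¬ T miss

      -- A vertex that dominates `T` is adjacent to the whole hull by definition; by `hull-closed`,
      -- any other vertex with a neighbour in the hull belongs to it.
      hull-module : Module W (hull W T)
      hull-module {w} {x} {y} Ww ¬Mw Mx (Wy , _ , z~y) w~x with All.all? (adj? G w) T
      ... | yes dom = z~y w Ww dom
      ... | no ¬dom = contradiction (hull-closed Ww ¬dom Mx w~x) ¬Mw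

      T⊆hull : ∀ {t} → t ∈ T → hull W T t
      T⊆hull t∈ = All.lookup T⊆W t∈ , (λ dom → independent t∈ t∈ (All.lookup dom t∈)) ,
        λ _ _ dom → All.lookup dom t∈

      -- The dominating vertex `b` lies outside the hull, so the `k`-colouring of `W` without `b`
      -- colours the hull.
      hull-critical : ∀ {k b t} → Critical k W → W b → Dominates b T → t ∈ T →
        ∃[ m ] m < k × Critical m (hull W T)
      hull-critical {b = b} crit Wb dom t∈ =
        module-critical (hull? W? T) proj₁ hull-module crit (_ , T⊆hull t∈)
          (Col-⊆ (λ { (Wx , ¬dom , _) → Wx , λ { refl → ¬dom dom } }) (proj₂ crit Wb))

    -- Bounding degrees.

    degree≤ : ∀ {k N W b} → Decidable W → Critical k W →
      (∀ {m M} → Decidable M → m < k → Critical m M → Size≤ M N) →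
      W b → Size≤ (λ u → W u × b ~ u) (degreeBound k N)
    degree≤ {k} {N} {W} {b} W? crit smaller Wb {xs} xs! nbrs =
      ≮⇒≥ λ big → absurd (ramsey (adj? G) (2 + k) (independentBound k N) xs! (<⇒≤ big))
      where
      col : Col (suc k) W
      col = critical⇒Col crit Wb
      absurd : Clique≥ (adj? G) (2 + k) xs ⊎ Stable≥ (adj? G) (independentBound k N) xs → ⊥
      -- A clique on `2 + k` vertices cannot be coloured with `suc k` colours.
      absurd (inj₁ (C , C⊆ , clique , len)) =
        <⇒≱ len (clique≤ col (All.tabulate (proj₁ ∘ All.lookup nbrs ∘ C⊆)) clique)
      absurd (inj₂ (S , S⊆ , S! , S≁ , len))
        -- Both cliques of defects start empty, so the number of permitted deletions must itself
        -- exceed `suc k + suc k`.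
        with prune W? col N (suc (suc k + suc k)) {C = []} {D = []} S! (independent⁺ S≁)
          ([] , []) ([] , []) (λ ()) len (m≤m+n _ 0)
      ... | T , T⊆ , T! , none , N< = finish T refl
        where
        T⊆N : ∀ {t} → t ∈ T → W t × b ~ t
        T⊆N = All.lookup nbrs ∘ S⊆ ∘ T⊆
        T⊆W : All W T
        T⊆W = All.tabulate (proj₁ ∘ T⊆N)
        T≁ : Independent T
        T≁ s∈ t∈ = independent⁺ S≁ (T⊆ s∈) (T⊆ t∈)
        finish : ∀ T′ → T′ ≡ T → ⊥
        finish [] refl = contradiction N< λ ()
        finish (_ ∷ _) refl
          with hull-critical W? T⊆W T≁ none crit Wb (All.tabulate (proj₂ ∘ T⊆N)) (here refl)
        -- The hull is critical for fewer colours, hence has at most `N` vertices, but it contains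
        -- `T`.
        ... | m , m<k , crit′ = <⇒≱ N<
          (smaller (hull? W? T) m<k crit′ T! (All.tabulate (T⊆hull W? T⊆W T≁ none)))

    -- Balls of radius three and the bound on the size.

    module _ {W : Subset} (W? : Decidable W) where

      neighbours : Fin n → List (Fin n)
      neighbours u = filter (λ x → W? x ×-dec adj? G u x) (allFin n)

      ball : ℕ → Fin n → List (Fin n)
      ball zero    v = [ v ]
      ball (suc r) v = concatMap (λ u → u ∷ neighbours u) (ball r v)

      ball-⊆ : ∀ {v x} r → x ∈ ball r v → x ∈ ball (suc r) v
      ball-⊆ r x∈ = ∈-concatMap⁺ _ (Any.map (λ { refl → here refl }) x∈)

      ball-step : ∀ {v x y} r → x ∈ ball r v → W y → x ~ y → y ∈ ball (suc r) v
      ball-step r x∈ Wy xy = ∈-concatMap⁺ _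
        (Any.map (λ { refl → there (∈-filter⁺ _ (∈-allFin _) (Wy , xy)) }) x∈)

      ball⁻ : ∀ {v y} r → y ∈ ball (suc r) v →
        y ∈ ball r v ⊎ ∃[ x ] x ∈ ball r v × W y × x ~ y
      ball⁻ {v} {y} r y∈ with find (∈-concatMap⁻ (λ u → u ∷ neighbours u) {xs = ball r v} y∈)
      ... | x , x∈ , here refl = inj₁ x∈
      ... | x , x∈ , there y∈N with ∈-filter⁻ (λ x′ → W? x′ ×-dec adj? G x x′) {xs = allFin n} y∈N
      ...   | _ , Wy , xy = inj₂ (x , x∈ , Wy , xy)

      ball⊆W : ∀ {v x} → W v → ∀ r → x ∈ ball r v → W x
      ball⊆W Wv zero    (here refl) = Wv
      ball⊆W Wv (suc r) x∈ with ball⁻ r x∈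
      ... | inj₁ x∈r           = ball⊆W Wv r x∈r
      ... | inj₂ (_ , _ , Wx , _) = Wx

      -- A vertex at distance four from v would give an induced P₅.
      ball-closed : ∀ {v x y} → x ∈ ball 3 v → W y → x ~ y → y ∈ ball 3 v
      ball-closed {v} {x₃} {x₄} x₃∈ Wx₄ x₃x₄ = decidable-stable (x₄ ∈? ball 3 v) go
        where
        open DecMembership {A = Fin n} _≟_ using (_∈?_)
        go : ¬ x₄ ∉ ball 3 v
        go x₄∉ with ball⁻ 2 x₃∈
        ... | inj₁ x₃∈₂ = x₄∉ (ball-step 2 x₃∈₂ Wx₄ x₃x₄)
        ... | inj₂ (x₂ , x₂∈ , Wx₃ , x₂x₃) with ball⁻ 1 x₂∈
        ...   | inj₁ x₂∈₁ = x₄∉ (ball-step 2 (ball-step 1 x₂∈₁ Wx₃ x₂x₃) Wx₄ x₃x₄)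
        ...   | inj₂ (x₁ , x₁∈ , Wx₂ , x₁x₂) with ball⁻ 0 x₁∈
        ...     | inj₁ (here refl) =
          x₄∉ (ball-step 2 (ball-step 1 (ball-step 0 (here refl) Wx₂ x₁x₂) Wx₃ x₂x₃) Wx₄ x₃x₄)
        ...     | inj₂ (_ , here refl , Wx₁ , x₀x₁) =
          no-P₅ P₅-free x₀x₁ x₁x₂ x₂x₃ x₃x₄
            (λ x₀x₂ → x₃∉₂ (ball-step 1 (ball-step 0 (here refl) Wx₂ x₀x₂) Wx₃ x₂x₃))
            (λ x₀x₃ → x₃∉₂ (ball-⊆ 1 (ball-step 0 (here refl) Wx₃ x₀x₃)))
            (λ x₀x₄ → x₄∉ (ball-⊆ 2 (ball-⊆ 1 (ball-step 0 (here refl) Wx₄ x₀x₄))))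
            (λ x₁x₃ → x₃∉₂ (ball-step 1 x₁∈ Wx₃ x₁x₃))
            (λ x₁x₄ → x₄∉ (ball-⊆ 2 (ball-step 1 x₁∈ Wx₄ x₁x₄)))
            (λ x₂x₄ → x₄∉ (ball-step 2 x₂∈ Wx₄ x₂x₄))
          where
          x₃∉₂ : x₃ ∉ ball 2 v
          x₃∉₂ x₃∈₂ = x₄∉ (ball-step 2 x₃∈₂ Wx₄ x₃x₄)

      length-ball : ∀ {d v} → (∀ u → W u → length (neighbours u) ≤ d) → W v → ∀ r →
        length (ball r v) ≤ suc d ^ r
      length-ball deg Wv zero = ≤-refl
      length-ball {d} {v} deg Wv (suc r) = ≤-trans
        (length-concatMap-≤ (ball r v) (λ x∈ → s≤s (deg _ (ball⊆W Wv r x∈))))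
        (≤-trans (*-monoˡ-≤ (suc d) (length-ball deg Wv r))
          (≤-reflexive (*-comm (suc d ^ r) (suc d))))

    -- Only the largest value of `m` is new. There the recursive bound feeds `degree≤`, and a ball
    -- of radius three, being closed under adjacency in `W`, exhausts `W` by connectedness.
    size≤ : ∀ k {m W} → Decidable W → m < k → Critical m W → Size≤ W (sizeBound k)
    size≤ (suc k) {m} {W} W? m<1+k crit {xs} xs! Wxs with m <? k
    ... | yes m<k = m≤n⇒m≤n⊔o _ (size≤ k W? m<k crit xs! Wxs)
    ... | no m≮k with ≤-antisym (s≤s⁻¹ m<1+k) (≮⇒≥ m≮k) | critical⇒nonempty W? crit
    ...   | refl | v , Wv = m≤n⇒m≤o⊔n _ (≤-trans
      (unique-⊆⇒length≤ _≟_ xs! λ x∈ →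
        critical-connected (_∈? ball W? 3 v) crit (ball-closed W?) Wv
          (ball-⊆ W? 2 (ball-⊆ W? 1 (ball-⊆ W? 0 (here refl)))) (All.lookup Wxs x∈))
      (length-ball W? (λ u Wu → degree≤ W? crit (size≤ k) Wu
        (Unique.filter⁺ _ (Unique.allFin⁺ n)) (all-filter _ (allFin n))) Wv 3))
      where open DecMembership {A = Fin n} _≟_ using (_∈?_)

-- From vertex deletion to subsets of a fixed vertex set.

Colourable⇔Col : ∀ {n k} {G : Graph n} → Colourable G k ⇔ Col G k (λ _ → ⊤)
Colourable⇔Col {n} {k} {G} = mk⇔
  (λ (c , proper) → toℕ ∘ c , (λ _ → toℕ<n _) , λ _ _ uv → proper _ _ uv ∘ toℕ-injective)
  (λ (c , c< , proper) → (λ u → fromℕ< (c< {u} _)) ,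
    λ u v uv eq → proper _ _ uv
      (trans (≡-sym (toℕ-fromℕ< (c< _))) (trans (cong toℕ eq) (toℕ-fromℕ< (c< _)))))

Colourable-delete⇒Col : ∀ {n k} {G : Graph n} (v : Fin n) →
  Colourable (G − v) k → Col G k (λ u → ⊤ × u ≢ v)
Colourable-delete⇒Col {suc n} {k} {G} v (c , proper) = c′ , c′< , proper′
  where
  c′ : Fin (suc n) → ℕ
  c′ u with u ≟ v
  -- A dummy value, as `v` lies outside the coloured subset.
  ... | yes _  = 0
  ... | no u≢v = toℕ (c (punchOut (u≢v ∘ ≡-sym)))
  c′< : ∀ {u} → ⊤ × u ≢ v → c′ u < k
  c′< {u} (_ , u≢v) with u ≟ v
  ... | yes u≡v = contradiction u≡v u≢v
  ... | no _    = toℕ<n _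
  proper′ : ∀ {u w} → ⊤ × u ≢ v → ⊤ × w ≢ v → Adj G u w → c′ u ≢ c′ w
  proper′ {u} {w} (_ , u≢v) (_ , w≢v) uw with u ≟ v | w ≟ v
  ... | yes u≡v | _       = contradiction u≡v u≢v
  ... | no _    | yes w≡v = contradiction w≡v w≢v
  ... | no u≢v′ | no w≢v′ = proper _ _
    (subst₂ (Adj G) (≡-sym (punchIn-punchOut (u≢v′ ∘ ≡-sym)))
      (≡-sym (punchIn-punchOut (w≢v′ ∘ ≡-sym))) uw)
    ∘ toℕ-injective

vertexCritical⇒critical : ∀ {n k} {G : Graph n} → VertexCritical (suc k) G → Critical G k (λ _ → ⊤)
vertexCritical⇒critical {k = k} {G = G} ((_ , ¬col) , deletions) =
  (¬col k ≤-refl ∘ Equivalence.from (Colourable⇔Col {G = G})) , critical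
  where
  critical : ∀ {v} → ⊤ → Col G k (λ u → ⊤ × u ≢ v)
  critical {v} _ with deletions v
  ... | j , (col , _) , j<1+k = Col-≤ G (s≤s⁻¹ j<1+k) (Colourable-delete⇒Col {G = G} v col)

vertexCritical-size≤ : ∀ {n k} {G : Graph n} →
  VertexCritical (suc k) G → ⟨ P₅ , chair ⟩-Free G → n ≤ sizeBound (suc k)
vertexCritical-size≤ {n} {k} {G} crit (P₅-free , chair-free) =
  subst (_≤ sizeBound (suc k)) (length-tabulate id)
    (size≤ G P₅-free chair-free (suc k) (λ _ → yes tt) (n<1+n k)
      (vertexCritical⇒critical {G = G} crit) (Unique.allFin⁺ n) (All.tabulate _))

-- Decidability of the properties in the theorem.

Colourable? : ∀ {n} (G : Graph n) k → Dec (Colourable G k)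
Colourable? G k = map′ from to (Col? G (λ _ → yes tt))
  where open Equivalence (Colourable⇔Col {k = k} {G})

χ? : ∀ {n} (G : Graph n) k → Dec (χ G ≔ k)
χ? G k = Colourable? G k ×-dec
  map′ (λ h j → h {j}) (λ h {j} → h j) (allUpTo? (λ j → ¬? (Colourable? G j)) k)

VertexCritical? : ∀ k {n} (G : Graph n) → Dec (VertexCritical k G)
VertexCritical? k G = χ? G k ×-dec all? λ v →
  map′ (λ (j , j<k , χj) → j , χj , j<k) (λ (j , χj , j<k) → j , j<k , χj)
    (anyUpTo? (χ? (G − v)) k)

Embeds : ∀ {m n} → Graph m → Graph n → (Fin m → Fin n) → Set
Embeds F G f = ∀ i j →
  (f i ≡ f j → i ≡ j) × (Adj F i j → Adj G (f i) (f j)) × (Adj G (f i) (f j) → Adj F i j)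

_⊑?_ : ∀ {m n} (F : Graph m) (G : Graph n) → Dec (F ⊑ G)
_⊑?_ {m} {n} F G = map′ from to (any? (embeds? ∘ finToFun))
  where
  embeds? : Decidable (Embeds F G)
  embeds? f = all? λ i → all? λ j → ((f i ≟ f j) →-dec (i ≟ j)) ×-dec
    (adj? F i j →-dec adj? G (f i) (f j)) ×-dec (adj? G (f i) (f j) →-dec adj? F i j)
  from : ∃ (Embeds F G ∘ finToFun) → F ⊑ G
  from (i , e) = record
    { embedding = mk↣ (λ {u} {v} → proj₁ (e u v))
    ; adj-⇔ = λ u v → mk⇔ (proj₁ (proj₂ (e u v))) (proj₂ (proj₂ (e u v)))
    }
  to : F ⊑ G → ∃ (Embeds F G ∘ finToFun)
  -- Decoding the code of `f` gives back `f` only pointwise, so the conditions are transported value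
  -- by value.
  to F⊑G = funToFin f , λ i j → subst₂ (Good i j)
    (≡-sym (finToFun-funToFin f i)) (≡-sym (finToFun-funToFin f j))
    (Injection.injective embedding , Equivalence.to (adj-⇔ i j) , Equivalence.from (adj-⇔ i j))
    where
    open _⊑_ F⊑G
    f = Injection.to embedding
    Good : Fin m → Fin m → Fin n → Fin n → Set
    Good i j u v = (u ≡ v → i ≡ j) × (Adj F i j → Adj G u v) × (Adj G u v → Adj F i j)

-- Invariance under equivalence of adjacency.

infix 4 _≃_
-- Adjacency is an arbitrary decidable relation, so graphs with the same edges need not be
-- identified by `_≡_`; properties are carried along this relation instead.
_≃_ : ∀ {n} → Graph n → Graph n → Set
G ≃ H = ∀ u v → Adj G u v ⇔ Adj H u v

≃-sym : ∀ {n} {G H : Graph n} → G ≃ H → H ≃ G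
≃-sym G≃H u v = ⇔-sym (G≃H u v)

≃⇒≅ : ∀ {n} {G H : Graph n} → G ≃ H → G ≅ H
≃⇒≅ G≃H = record { bijection = ↔-id _ ; adj-⇔ = G≃H }

Colourable-resp-≃ : ∀ {n k} {G H : Graph n} → G ≃ H → Colourable G k → Colourable H k
Colourable-resp-≃ G≃H (c , proper) = c , λ u v uv → proper u v (Equivalence.from (G≃H u v) uv)

χ-resp-≃ : ∀ {n k} {G H : Graph n} → G ≃ H → χ G ≔ k → χ H ≔ k
χ-resp-≃ {G = G} {H} G≃H (col , min) = Colourable-resp-≃ {G = G} {H} G≃H col ,
  λ j j<k → min j j<k ∘ Colourable-resp-≃ {G = H} {G} (≃-sym {G = G} {H} G≃H)

−-resp-≃ : ∀ {n} {G H : Graph n} → G ≃ H → ∀ v → (G − v) ≃ (H − v)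
−-resp-≃ {suc n} G≃H v i j = G≃H (punchIn v i) (punchIn v j)

VertexCritical-resp-≃ : ∀ {n k} {G H : Graph n} → G ≃ H → VertexCritical k G → VertexCritical k H
VertexCritical-resp-≃ {G = G} {H} G≃H (χG , deletions) = χ-resp-≃ {G = G} {H} G≃H χG , λ v →
  let j , χj , j<k = deletions v in
  j , χ-resp-≃ {G = G − v} {H − v} (−-resp-≃ {G = G} {H} G≃H v) χj , j<k

⊑-resp-≃ : ∀ {m n} {F : Graph m} {G H : Graph n} → G ≃ H → F ⊑ G → F ⊑ H
⊑-resp-≃ G≃H F⊑G = record
  { embedding = embedding
  ; adj-⇔ = λ u v → G≃H _ _ ⇔-∘ adj-⇔ u v
  }
  where open _⊑_ F⊑G

-- Enumeration of the graphs of bounded order.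

-- The code is an adjacency matrix of bits. Symmetrising it and ignoring its diagonal turns every
-- code into a graph.
decode : ∀ n → Fin (2 ^ (n * n)) → Graph n
decode n code = record
  { Adj    = λ u v → u ≢ v × (bit u v ⊎ bit v u)
  ; adj?   = λ u v → ¬? (u ≟ v) ×-dec (bit? u v ⊎-dec bit? v u)
  ; sym    = λ (u≢v , b) → u≢v ∘ ≡-sym , Sum.swap b
  ; irrefl = λ v (v≢v , _) → v≢v refl
  }
  where
  bit : Fin n → Fin n → Set
  bit u v = finToFun code (combine u v) ≡ suc zero
  bit? : ∀ u v → Dec (bit u v)
  bit? u v = finToFun code (combine u v) ≟ suc zero

encode : ∀ {n} (G : Graph n) → ∃[ code ] G ≃ decode n code
encode {n} G = funToFin bits , λ u v → mk⇔
    (λ uv → ~⇒≢ G uv , inj₁ (trans (finToFun-funToFin bits (combine u v)) (bits⁺ uv)))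
    (λ { (_ , inj₁ b) → bits⁻ b ; (_ , inj₂ b) → sym G (bits⁻ b) })
  where
  bitOf : ∀ {P : Set} → Dec P → Fin 2
  bitOf (yes _) = suc zero
  bitOf (no  _) = zero
  bits : Fin (n * n) → Fin 2
  bits p = bitOf (adj? G (proj₁ (remQuot {n} n p)) (proj₂ (remQuot {n} n p)))
  bits-combine : ∀ u v → bits (combine u v) ≡ bitOf (adj? G u v)
  bits-combine u v = cong (λ (u , v) → bitOf (adj? G u v)) (remQuot-combine u v)
  bits⁺ : ∀ {u v} → Adj G u v → bits (combine u v) ≡ suc zero
  bits⁺ {u} {v} uv with adj? G u v | bits-combine u v
  ... | yes _  | eq = eq
  ... | no ¬uv | _  = contradiction uv ¬uv
  bits⁻ : ∀ {u v} → finToFun (funToFin bits) (combine u v) ≡ suc zero → Adj G u v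
  bits⁻ {u} {v} b with adj? G u v | trans (≡-sym (bits-combine u v))
    (trans (≡-sym (finToFun-funToFin bits (combine u v))) b)
  ... | yes uv | _ = uv
  ... | no _   | ()

graphs≤ : ℕ → List FiniteGraph
graphs≤ N = concatMap (λ n → map (λ code → n , decode n code) (allFin _)) (upTo (suc N))

decode∈graphs≤ : ∀ {N n} code → n ≤ N → (n , decode n code) ∈ graphs≤ N
decode∈graphs≤ {N} {n} code n≤N = ∈-concatMap⁺
  (λ n → map (λ code → n , decode n code) (allFin _))
  (Any.map (λ { refl → ∈-map⁺ _ (∈-allFin code) }) (∈-upTo⁺ (s≤s n≤N)))

-- Decidability allows the list of all small graphs to be filtered by `P`, and invariance carries
-- `P` from `G` to its decoded copy in that list.
finitelyMany : ∀ {P : ∀ {n} → Graph n → Set} → (∀ {n} (G : Graph n) → Dec (P G)) →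
  (∀ {n} {G H : Graph n} → G ≃ H → P G → P H) →
  ∀ N → (∀ {n} (G : Graph n) → P G → n ≤ N) → FinitelyManyUpToIso P
finitelyMany {P} P? P-resp N P≤ =
  filter holds? (graphs≤ N) , all-filter holds? (graphs≤ N) , covered
  where
  holds? : ∀ ((_ , H) : FiniteGraph) → Dec (P H)
  holds? (_ , H) = P? H
  covered : ∀ {n} (G : Graph n) → P G → Any ((n , G) ≅ᶠ_) (filter holds? (graphs≤ N))
  covered {n} G PG with encode G
  ... | code , G≃H = Any.map (λ { refl → ≃⇒≅ G≃H })
    (∈-filter⁺ holds? (decode∈graphs≤ code (P≤ G PG)) (P-resp {G = G} {decode n code} G≃H PG))

theorem4 : (k : ℕ) → k ≥ 1 →
    FinitelyManyUpToIso (λ G → VertexCritical k G × ⟨ P₅ , chair ⟩-Free G)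
theorem4 (suc k) _ = finitelyMany
  (λ G → VertexCritical? (suc k) G ×-dec ¬? (P₅ ⊑? G) ×-dec ¬? (chair ⊑? G))
  (λ {_} {G} {H} G≃H (crit , P₅-free , chair-free) →
    VertexCritical-resp-≃ {G = G} {H} G≃H crit ,
    P₅-free ∘ ⊑-resp-≃ {G = H} {G} (≃-sym {G = G} {H} G≃H) ,
    chair-free ∘ ⊑-resp-≃ {G = H} {G} (≃-sym {G = G} {H} G≃H))
  (sizeBound (suc k))
  (λ G (crit , free) → vertexCritical-size≤ {G = G} crit free)
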